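{- For integers $\ell,m,p$, let $\mathfrak a_{\ell,m,p}$ be the number of inversion sequences $\sigma\in\mathcal{I}_\ell(100,101)$ such that $\max(\sigma)=m$ and the value $m$ appears exactly once in $\sigma$, at position $p$. Then for all $n\geqslant 2$, $$|\mathcal{I}_n(100,101)|=\sum_{\ell=1}^{n}\sum_{m=0}^{\ell-1}\sum_{p=m+1}^{\ell}\mathfrak a_{\ell,m,p}.$$
   Context: For $n\in\mathbb N$, an inversion sequence of size $n$ is a sequence $\sigma=(\sigma_1,\dots,\sigma_n)\in\mathbb N^n$ with $\sigma_i<i$ for all $i$. An integer sequence contains a pattern $\rho$ (a finite integer sequence such as $100$ or $101$) if it has a subsequence order-isomorphic to $\rho$, and avoids $\rho$ otherwise. $\mathcal{I}_n(P)$ denotes the set of inversion sequences of size $n$ avoiding every pattern in the set $P$. $\max(\sigma)$ is the largest entry of $\sigma$. -}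

module Defs where

open import Data.Nat using (ℕ; zero; suc; _+_; _∸_; _≤_; _<_)
open import Data.Fin using (Fin; toℕ; cast)
open import Data.List using (List; []; _∷_; length; lookup; map; upTo)
open import Data.Nat.ListAction using (sum)
open import Data.List.Relation.Binary.Sublist.Propositional using (_⊆_)
open import Data.List.Membership.Propositional using (_∈_)
open import Data.List.Relation.Unary.Unique.Propositional using (Unique)
open import Data.Product using (Σ; ∃; _×_; _,_)
open import Relation.Nullary using (¬_)
open import Relation.Binary.PropositionalEquality using (_≡_)
open import Function.Bundles using (_⇔_)

-- Inversion sequence of size n: σ = (σ₁,…,σₙ) with σᵢ < i (1-indexed).
-- With 0-indexed Fin position i, the condition reads  σ[i] < i + 1.
InvSeq : ℕ → List ℕ → Set
InvSeq n σ = (length σ ≡ n) × (∀ (i : Fin (length σ)) → lookup σ i < suc (toℕ i))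

-- τ is order-isomorphic to ρ: same length, and for all positions i j,
-- τᵢ < τⱼ iff ρᵢ < ρⱼ (this also determines equalities).
OrderIso : List ℕ → List ℕ → Set
OrderIso τ ρ = Σ (length τ ≡ length ρ) λ eq →
  ∀ (i j : Fin (length τ)) →
    (lookup τ i < lookup τ j) ⇔ (lookup ρ (cast eq i) < lookup ρ (cast eq j))

Contains : List ℕ → List ℕ → Set
Contains s ρ = ∃ λ τ → (τ ⊆ s) × OrderIso τ ρ

Avoids : List ℕ → List ℕ → Set
Avoids s ρ = ¬ Contains s ρ

p100 : List ℕ
p100 = 1 ∷ 0 ∷ 0 ∷ []

p101 : List ℕ
p101 = 1 ∷ 0 ∷ 1 ∷ []

InI : ℕ → List ℕ → Set
InI n σ = InvSeq n σ × Avoids σ p100 × Avoids σ p101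

MaxOnceAt : ℕ → ℕ → List ℕ → Set
MaxOnceAt m p σ =
  (∀ (j : Fin (length σ)) → lookup σ j ≤ m) ×
  (Σ (Fin (length σ)) λ i →
     (suc (toℕ i) ≡ p) × (lookup σ i ≡ m) ×
     (∀ (j : Fin (length σ)) → lookup σ j ≡ m → j ≡ i))

ASet : ℕ → ℕ → ℕ → List ℕ → Set
ASet ℓ m p σ = InI ℓ σ × MaxOnceAt m p σ

HasCard : (List ℕ → Set) → ℕ → Set
HasCard P k = ∃ λ xs → Unique xs × (∀ x → (x ∈ xs) ⇔ P x) × (length xs ≡ k)

-- Σ_{i=a}^{b} f i  (empty, i.e. 0, when b < a)
sumFromTo : ℕ → ℕ → (ℕ → ℕ) → ℕ
sumFromTo a b f = sum (map (λ k → f (a + k)) (upTo (suc b ∸ a)))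

-- An inversion sequence in 𝓘ₙ(100,101), n ≥ 1, either contains its maximum m exactly
-- once, or at least twice. The former are counted by the 𝔞_{n,m,p}, grouped by m and by
-- the position p of m, where m < p ≤ n. In the latter case, avoiding 101 forces the first
-- two copies of m to be adjacent, so deleting the first copy is a bijection onto
-- 𝓘ₙ₋₁(100,101); its inverse duplicates the first copy of the maximum, which creates no
-- 100 or 101 since both patterns start with a descent. Hence
-- |𝓘ₙ| = Σ_{m,p} 𝔞_{n,m,p} + |𝓘ₙ₋₁| for n ≥ 2, while the only element of 𝓘₁ is (0).
module Submission where

open import Defs
open import Data.Nat using (ℕ; zero; suc; _+_; _∸_; _≤_; _<_; _≟_; z≤n; s≤s; s≤s⁻¹)
open import Data.Nat.Properties
  using ( ≟-diag; suc-injective; +-suc; +-identityʳ; m≢1+m+n; m+[n∸m]≡n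
        ; <-irrefl; <-asym; <⇒≱; <⇒≤; ≤∧≢⇒<; ≤-trans; ≤-<-trans; <-≤-trans
        ; n≤1+n; m<n⇒m<1+n; n≤0⇒n≡0 )
open import Data.Fin using (zero; suc; toℕ)
open import Data.Fin.Properties using (toℕ<n; toℕ-injective)
open import Data.List using (List; []; _∷_; [_]; _++_; length; lookup; map; filter; upTo; applyUpTo)
open import Data.List.Properties using (length-map; map-++; map-applyUpTo; map-upTo; upTo-∷ʳ)
open import Data.Nat.ListAction using (sum)
open import Data.Nat.ListAction.Properties using (sum-++)
open import Data.List.Extrema.Nat using (max; xs≤max; max≈v⁺; argmax-sel)
open import Data.List.Membership.Propositional using (_∈_; _∉_)
open import Data.List.Membership.Propositional.Properties
  using (∈-lookup; ∈-filter⁺; ∈-filter⁻; ∈-map⁺; ∈-map⁻)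
open import Data.List.Membership.Propositional.Properties.WithK using (unique∧set⇒bag)
open import Data.List.Membership.DecPropositional _≟_ using (_∈?_)
open import Data.List.Relation.Unary.Any using (here; there; index)
open import Data.List.Relation.Unary.Any.Properties using (lookup-index)
open import Data.List.Relation.Unary.All as All using (All; []; _∷_)
open import Data.List.Relation.Unary.Unique.Propositional using (Unique; []; _∷_)
import Data.List.Relation.Unary.Unique.Propositional.Properties as Unique
open import Data.List.Relation.Binary.BagAndSetEquality using (∼bag⇒↭)
open import Data.List.Relation.Binary.Permutation.Propositional.Properties using (↭-length)
import Data.List.Relation.Binary.Sublist.Propositional as Sublist
open Sublist using (_⊆_; []; _∷_; _∷ʳ_; ⊆-refl; ⊆-trans; from∈)
open import Data.List.Relation.Binary.Sublist.Propositional.Properties using (All-resp-⊆)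
open import Data.Product using (∃; ∃₂; _×_; _,_)
open import Data.Sum as Sum using (_⊎_; inj₁; inj₂)
open import Data.Unit using (⊤; tt)
open import Relation.Nullary using (¬_; ¬?; yes; no; contradiction)
open import Relation.Nullary.Decidable using (dec-no)
open import Relation.Unary using (Decidable; Empty)
open import Relation.Binary.PropositionalEquality
  using (_≡_; _≢_; refl; sym; trans; cong; cong₂; subst; subst₂; module ≡-Reasoning)
open import Function using (_∘_; id)
open import Function.Bundles using (_⇔_; mk⇔; Equivalence)

open Equivalence using (to; from)

private
  variable
    P Q : List ℕ → Set
    k k′ m n p q x y r₀ r₁ r₂ : ℕ
    σ τ ω ρ : List ℕ

HasCard-unique : HasCard P k → HasCard P k′ → k ≡ k′
HasCard-unique (xs , xs! , ∈xs , refl) (ys , ys! , ∈ys , refl) =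
  ↭-length (∼bag⇒↭ (unique∧set⇒bag xs! ys! λ {x} →
    mk⇔ (from (∈ys x) ∘ to (∈xs x)) (from (∈xs x) ∘ to (∈ys x))))

HasCard-resp-⇔ : (∀ x → P x ⇔ Q x) → HasCard P k → HasCard Q k
HasCard-resp-⇔ P⇔Q (xs , xs! , ∈xs , len) =
  xs , xs! , (λ x → mk⇔ (to (P⇔Q x) ∘ to (∈xs x)) (from (∈xs x) ∘ from (P⇔Q x))) , len

HasCard-empty : Empty P → HasCard P k → k ≡ 0
HasCard-empty ∅ ([] , _ , _ , refl) = refl
HasCard-empty ∅ (x ∷ _ , _ , ∈xs , _) = contradiction (to (∈xs x) (here refl)) (∅ x)

length-filter-complement : (Q? : Decidable Q) (xs : List (List ℕ)) →
  length xs ≡ length (filter Q? xs) + length (filter (¬? ∘ Q?) xs)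
length-filter-complement Q? [] = refl
length-filter-complement Q? (x ∷ xs) with Q? x
... | yes _ = cong suc (length-filter-complement Q? xs)
... | no _ = trans (cong suc (length-filter-complement Q? xs)) (sym (+-suc _ _))

HasCard-partition : HasCard P k → Decidable Q →
  ∃₂ λ k₁ k₂ → HasCard (λ x → P x × Q x) k₁ × HasCard (λ x → P x × ¬ Q x) k₂ × k ≡ k₁ + k₂
HasCard-partition {P = P} (xs , xs! , ∈xs , refl) Q? =
  _ , _ , part Q? , part (¬? ∘ Q?) , length-filter-complement Q? xs
  where
  part : ∀ {R : List ℕ → Set} (R? : Decidable R) → HasCard (λ x → P x × R x) (length (filter R? xs))
  part R? = filter R? xs , Unique.filter⁺ R? xs! , (λ x → mk⇔
    (λ x∈ → let (x∈xs , Rx) = ∈-filter⁻ R? x∈ in to (∈xs x) x∈xs , Rx)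
    (λ (Px , Rx) → ∈-filter⁺ R? (from (∈xs x) Px) Rx)) , refl

Unique-map⁺ : ∀ (f g : List ℕ → List ℕ) {xs} → (∀ {x} → x ∈ xs → g (f x) ≡ x) →
  Unique xs → Unique (map f xs)
Unique-map⁺ f g {[]} _ [] = []
Unique-map⁺ f g {x ∷ xs} g∘f≡id (x∉xs ∷ xs!) =
  distinct x∉xs (g∘f≡id ∘ there) ∷ Unique-map⁺ f g (g∘f≡id ∘ there) xs!
  where
  distinct : ∀ {ys} → All (x ≢_) ys → (∀ {y} → y ∈ ys → g (f y) ≡ y) → All (f x ≢_) (map f ys)
  distinct [] _ = []
  distinct (x≢y ∷ x≢ys) g∘f≡id′ =
    (λ fx≡fy → x≢y (trans (sym (g∘f≡id (here refl))) (trans (cong g fx≡fy) (g∘f≡id′ (here refl)))))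
    ∷ distinct x≢ys (g∘f≡id′ ∘ there)

HasCard-bijection : (f g : List ℕ → List ℕ) →
  (∀ {x} → P x → Q (f x)) → (∀ {y} → Q y → P (g y)) →
  (∀ {x} → P x → g (f x) ≡ x) → (∀ {y} → Q y → f (g y) ≡ y) →
  HasCard P k → HasCard Q k
HasCard-bijection {Q = Q} f g f∈ g∈ g∘f≡id f∘g≡id (xs , xs! , ∈xs , len) =
  map f xs , Unique-map⁺ f g (g∘f≡id ∘ to (∈xs _)) xs! , ∈map , trans (length-map f xs) len
  where
  ∈map : ∀ y → (y ∈ map f xs) ⇔ Q y
  ∈map y = mk⇔
    (λ y∈ → let (x , x∈xs , y≡fx) = ∈-map⁻ f y∈ in subst Q (sym y≡fx) (f∈ (to (∈xs x) x∈xs)))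
    (λ Qy → subst (_∈ map f xs) (f∘g≡id Qy) (∈-map⁺ f (from (∈xs (g y)) (g∈ Qy))))

HasCard-sum-fibres : ∀ (key : List ℕ → ℕ) a n (d : ℕ → ℕ) →
  (∀ {x} → P x → a ≤ key x × key x < a + n) →
  (∀ i {c} → HasCard (λ x → P x × key x ≡ a + i) c → c ≡ d i) →
  HasCard P k → k ≡ sum (map d (upTo n))
HasCard-sum-fibres key a zero d inRange fibre card =
  HasCard-empty (λ x Px → let (a≤key , key<a+0) = inRange Px in
    <-irrefl refl (<-≤-trans key<a+0 (subst (_≤ key x) (sym (+-identityʳ a)) a≤key))) card
HasCard-sum-fibres {P = P} key a (suc n) d inRange fibre card
  with k₁ , k₂ , card₁ , card₂ , refl ← HasCard-partition card (λ x → key x ≟ a) =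
  cong₂ _+_ (fibre 0 (HasCard-resp-⇔ (λ _ → mk⇔ at-a+0 at-a) card₁)) (begin
    k₂                            ≡⟨ HasCard-sum-fibres key (suc a) n (d ∘ suc) inRange′ fibre′ card₂ ⟩
    sum (map (d ∘ suc) (upTo n))      ≡⟨ cong sum (map-upTo (d ∘ suc) n) ⟩
    sum (applyUpTo (d ∘ suc) n)       ≡⟨ cong sum (map-applyUpTo suc d n) ⟨
    sum (map d (applyUpTo suc n))     ∎)
  where
  open ≡-Reasoning
  at-a+0 : ∀ {x} → P x × key x ≡ a → P x × key x ≡ a + 0
  at-a+0 (Px , e) = Px , trans e (sym (+-identityʳ a))
  at-a : ∀ {x} → P x × key x ≡ a + 0 → P x × key x ≡ a
  at-a (Px , e) = Px , trans e (+-identityʳ a)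
  inRange′ : ∀ {x} → P x × key x ≢ a → suc a ≤ key x × key x < suc a + n
  inRange′ {x} (Px , key≢a) = let (a≤key , key<) = inRange Px in
    ≤∧≢⇒< a≤key (key≢a ∘ sym) , subst (key x <_) (+-suc a n) key<
  fibre′ : ∀ i {c} → HasCard (λ x → (P x × key x ≢ a) × key x ≡ suc a + i) c → c ≡ d (suc i)
  fibre′ i = fibre (suc i) ∘ HasCard-resp-⇔ λ _ → mk⇔
    (λ ((Px , _) , e) → Px , trans e (sym (+-suc a i)))
    (λ (Px , e) → (Px , λ key≡a → m≢1+m+n a (trans (sym key≡a) (trans e (+-suc a i)))) ,
                  trans e (+-suc a i))

sum-upTo-suc : ∀ (f : ℕ → ℕ) n → sum (map f (upTo (suc n))) ≡ sum (map f (upTo n)) + f n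
sum-upTo-suc f n = begin
  sum (map f (upTo (suc n)))        ≡⟨ cong (sum ∘ map f) (upTo-∷ʳ n) ⟨
  sum (map f (upTo n ++ [ n ]))     ≡⟨ cong sum (map-++ f (upTo n) [ n ]) ⟩
  sum (map f (upTo n) ++ [ f n ])   ≡⟨ sum-++ (map f (upTo n)) [ f n ] ⟩
  sum (map f (upTo n)) + (f n + 0)  ≡⟨ cong (sum (map f (upTo n)) +_) (+-identityʳ (f n)) ⟩
  sum (map f (upTo n)) + f n        ∎
  where open ≡-Reasoning

delFirst : ℕ → List ℕ → List ℕ
delFirst m [] = []
delFirst m (x ∷ xs) with x ≟ m
... | yes _ = xs
... | no _ = x ∷ delFirst m xs

dupFirst : ℕ → List ℕ → List ℕ
dupFirst m [] = []
dupFirst m (x ∷ xs) with x ≟ m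
... | yes _ = x ∷ x ∷ xs
... | no _ = x ∷ dupFirst m xs

-- 0-based; junk (the length of the list) when m does not occur.
firstIdx : ℕ → List ℕ → ℕ
firstIdx m [] = 0
firstIdx m (x ∷ xs) with x ≟ m
... | yes _ = 0
... | no _ = suc (firstIdx m xs)

module _ {m : ℕ} where

  delFirst-⊆ : ∀ σ → delFirst m σ ⊆ σ
  delFirst-⊆ [] = []
  delFirst-⊆ (x ∷ xs) with x ≟ m
  ... | yes _ = x ∷ʳ ⊆-refl
  ... | no _ = refl ∷ delFirst-⊆ xs

  ⊆-dupFirst : ∀ τ → τ ⊆ dupFirst m τ
  ⊆-dupFirst [] = []
  ⊆-dupFirst (x ∷ xs) with x ≟ m
  ... | yes _ = x ∷ʳ ⊆-refl
  ... | no _ = refl ∷ ⊆-dupFirst xs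

  All-dupFirst : ∀ {P : ℕ → Set} → All P τ → All P (dupFirst m τ)
  All-dupFirst [] = []
  All-dupFirst {x ∷ _} (px ∷ pxs) with x ≟ m
  ... | yes _ = px ∷ px ∷ pxs
  ... | no _ = px ∷ All-dupFirst pxs

  length-delFirst : m ∈ σ → suc (length (delFirst m σ)) ≡ length σ
  length-delFirst {x ∷ _} m∈ with x ≟ m | m∈
  ... | yes _ | _ = refl
  ... | no x≢m | here m≡x = contradiction (sym m≡x) x≢m
  ... | no _ | there m∈xs = cong suc (length-delFirst m∈xs)

  length-dupFirst : m ∈ τ → length (dupFirst m τ) ≡ suc (length τ)
  length-dupFirst {x ∷ _} m∈ with x ≟ m | m∈
  ... | yes _ | _ = refl
  ... | no x≢m | here m≡x = contradiction (sym m≡x) x≢m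
  ... | no _ | there m∈xs = cong suc (length-dupFirst m∈xs)

  delFirst-dupFirst : ∀ τ → delFirst m (dupFirst m τ) ≡ τ
  delFirst-dupFirst [] = refl
  delFirst-dupFirst (x ∷ xs) with x ≟ m
  ... | yes refl rewrite ≟-diag (refl {x = m}) = refl
  ... | no x≢m rewrite dec-no (x ≟ m) x≢m = cong (x ∷_) (delFirst-dupFirst xs)

  ∉-delFirst-singleton : ∀ x → m ∉ delFirst m (x ∷ [])
  ∉-delFirst-singleton x with x ≟ m
  ... | yes _ = λ ()
  ... | no x≢m = λ { (here m≡x) → x≢m (sym m≡x) }

  firstIdx-lookup : m ∈ σ → ∃ λ i → toℕ i ≡ firstIdx m σ × lookup σ i ≡ m
  firstIdx-lookup {x ∷ _} m∈ with x ≟ m | m∈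
  ... | yes x≡m | _ = zero , refl , x≡m
  ... | no x≢m | here m≡x = contradiction (sym m≡x) x≢m
  ... | no _ | there m∈xs =
    let i , i≡ , σᵢ≡m = firstIdx-lookup m∈xs in suc i , cong suc i≡ , σᵢ≡m

  ∉-delFirst⇒firstIdx : ∀ σ → m ∉ delFirst m σ → ∀ j → lookup σ j ≡ m → toℕ j ≡ firstIdx m σ
  ∉-delFirst⇒firstIdx (x ∷ xs) m∉ j σⱼ≡m with x ≟ m | j
  ... | yes _ | zero = refl
  ... | yes _ | suc j = contradiction (subst (_∈ xs) σⱼ≡m (∈-lookup j)) m∉
  ... | no x≢m | zero = contradiction σⱼ≡m x≢m
  ... | no _ | suc j = cong suc (∉-delFirst⇒firstIdx xs (m∉ ∘ there) j σⱼ≡m)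

  ∈-delFirst⇒later-occurrence : ∀ σ → m ∈ delFirst m σ → ∃ λ j → lookup σ j ≡ m × firstIdx m σ < toℕ j
  ∈-delFirst⇒later-occurrence (x ∷ xs) m∈ with x ≟ m | m∈
  ... | yes _ | m∈xs = suc (index m∈xs) , sym (lookup-index m∈xs) , s≤s z≤n
  ... | no x≢m | here m≡x = contradiction (sym m≡x) x≢m
  ... | no _ | there m∈ =
    let j , σⱼ≡m , later = ∈-delFirst⇒later-occurrence xs m∈ in suc j , σⱼ≡m , s≤s later

  MaxOnceAt⇔ : MaxOnceAt m p σ ⇔ (All (_≤ m) σ × m ∈ σ × m ∉ delFirst m σ × suc (firstIdx m σ) ≡ p)
  MaxOnceAt⇔ {p} {σ} = mk⇔ to′ from′
    where
    to′ : MaxOnceAt m p σ → All (_≤ m) σ × m ∈ σ × m ∉ delFirst m σ × suc (firstIdx m σ) ≡ p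
    to′ (σ≤m , i , pos , σᵢ≡m , only-i)
      with m∈σ ← subst (_∈ σ) σᵢ≡m (∈-lookup i)
      with i′ , i′≡ , σᵢ′≡m ← firstIdx-lookup m∈σ
      with refl ← only-i i′ σᵢ′≡m =
      All.tabulate (λ x∈ → subst (_≤ m) (sym (lookup-index x∈)) (σ≤m (index x∈))) ,
      m∈σ ,
      (λ m∈ → let j , σⱼ≡m , later = ∈-delFirst⇒later-occurrence σ m∈ in
        <-irrefl (trans (sym i′≡) (cong toℕ (sym (only-i j σⱼ≡m)))) later) ,
      trans (cong suc (sym i′≡)) pos
    from′ : All (_≤ m) σ × m ∈ σ × m ∉ delFirst m σ × suc (firstIdx m σ) ≡ p → MaxOnceAt m p σ
    from′ (σ≤m , m∈σ , m∉ , pos) =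
      let i , i≡ , σᵢ≡m = firstIdx-lookup m∈σ in
      (λ j → All.lookup σ≤m (∈-lookup j)) , i , trans (cong suc i≡) pos , σᵢ≡m ,
      λ j σⱼ≡m → toℕ-injective (trans (∉-delFirst⇒firstIdx σ m∉ j σⱼ≡m) (sym i≡))

  firstIdx-bounds : InvSeq n σ → m ∈ σ → m ≤ firstIdx m σ × firstIdx m σ < n
  firstIdx-bounds {σ = σ} (refl , σᵢ<i) m∈σ =
    let i , i≡ , σᵢ≡m = firstIdx-lookup m∈σ in
    subst₂ _≤_ σᵢ≡m i≡ (s≤s⁻¹ (σᵢ<i i)) , subst (_< length σ) i≡ (toℕ<n i)

-- The entries of an inversion sequence from (1-based) position p on.
InvSeqFrom : ℕ → List ℕ → Set
InvSeqFrom p [] = ⊤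
InvSeqFrom p (x ∷ xs) = x < p × InvSeqFrom (suc p) xs

InvSeqFrom⇔lookup : ∀ p σ → InvSeqFrom p σ ⇔ (∀ i → lookup σ i < p + toℕ i)
InvSeqFrom⇔lookup p σ = mk⇔ (to′ p σ) (from′ p σ)
  where
  to′ : ∀ p σ → InvSeqFrom p σ → ∀ i → lookup σ i < p + toℕ i
  to′ p (x ∷ xs) (x<p , _) zero = subst (x <_) (sym (+-identityʳ p)) x<p
  to′ p (x ∷ xs) (_ , xs-inv) (suc i) =
    subst (lookup xs i <_) (sym (+-suc p (toℕ i))) (to′ (suc p) xs xs-inv i)
  from′ : ∀ p σ → (∀ i → lookup σ i < p + toℕ i) → InvSeqFrom p σ
  from′ p [] _ = tt
  from′ p (x ∷ xs) σᵢ< =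
    subst (x <_) (+-identityʳ p) (σᵢ< zero) ,
    from′ (suc p) xs (λ i → subst (lookup xs i <_) (+-suc p (toℕ i)) (σᵢ< (suc i)))

InvSeqFrom-mono : p ≤ q → InvSeqFrom p σ → InvSeqFrom q σ
InvSeqFrom-mono {σ = []} _ _ = tt
InvSeqFrom-mono {σ = x ∷ xs} p≤q (x<p , xs-inv) =
  <-≤-trans x<p p≤q , InvSeqFrom-mono (s≤s p≤q) xs-inv

All<⇒InvSeqFrom : All (_< p) σ → InvSeqFrom p σ
All<⇒InvSeqFrom [] = tt
All<⇒InvSeqFrom (x<p ∷ xs<p) = x<p , InvSeqFrom-mono (n≤1+n _) (All<⇒InvSeqFrom xs<p)

module _ {m : ℕ} where

  -- Entries after the first m are at most m, hence below the position of that m.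
  delFirst-InvSeqFrom : m ∈ σ → All (_≤ m) σ → InvSeqFrom p σ → InvSeqFrom p (delFirst m σ)
  delFirst-InvSeqFrom {x ∷ _} m∈ (_ ∷ xs≤m) (x<p , xs-inv) with x ≟ m | m∈
  ... | yes refl | _ = All<⇒InvSeqFrom (All.map (λ y≤m → ≤-<-trans y≤m x<p) xs≤m)
  ... | no x≢m | here m≡x = contradiction (sym m≡x) x≢m
  ... | no _ | there m∈xs = x<p , delFirst-InvSeqFrom m∈xs xs≤m xs-inv

  dupFirst-InvSeqFrom : InvSeqFrom p τ → InvSeqFrom p (dupFirst m τ)
  dupFirst-InvSeqFrom {τ = []} _ = tt
  dupFirst-InvSeqFrom {τ = x ∷ _} (x<p , xs-inv) with x ≟ m
  ... | yes _ = x<p , m<n⇒m<1+n x<p , InvSeqFrom-mono (n≤1+n _) xs-inv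
  ... | no _ = x<p , dupFirst-InvSeqFrom xs-inv

Avoids-⊆ : τ ⊆ σ → Avoids σ ρ → Avoids τ ρ
Avoids-⊆ τ⊆σ σ-avoids (ω , ω⊆τ , ω≅ρ) = σ-avoids (ω , ⊆-trans ω⊆τ τ⊆σ , ω≅ρ)

occurrence-101 : y < m → OrderIso (m ∷ y ∷ m ∷ []) p101
occurrence-101 y<m = refl , λ where
    zero zero → neither (<-irrefl refl) (<-irrefl refl)
    zero (suc zero) → neither (<-asym y<m) λ ()
    zero (suc (suc zero)) → neither (<-irrefl refl) (<-irrefl refl)
    (suc zero) zero → both y<m (s≤s z≤n)
    (suc zero) (suc zero) → neither (<-irrefl refl) (<-irrefl refl)
    (suc zero) (suc (suc zero)) → both y<m (s≤s z≤n)
    (suc (suc zero)) zero → neither (<-irrefl refl) (<-irrefl refl)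
    (suc (suc zero)) (suc zero) → neither (<-asym y<m) λ ()
    (suc (suc zero)) (suc (suc zero)) → neither (<-irrefl refl) (<-irrefl refl)
  where
  both : ∀ {A B : Set} → A → B → A ⇔ B
  both a b = mk⇔ (λ _ → b) (λ _ → a)
  neither : ∀ {A B : Set} → ¬ A → ¬ B → A ⇔ B
  neither ¬a ¬b = mk⇔ (λ a → contradiction a ¬a) (λ b → contradiction b ¬b)

module _ {m : ℕ} where

  ⊆-dupFirst-cases : ω ⊆ dupFirst m τ → ω ⊆ τ ⊎ ∃₂ λ ys zs → ω ≡ ys ++ m ∷ m ∷ zs
  ⊆-dupFirst-cases {τ = []} ω⊆ = inj₁ ω⊆
  ⊆-dupFirst-cases {τ = x ∷ _} ω⊆ with x ≟ m | ω⊆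
  ... | yes _ | _ ∷ʳ (_ ∷ʳ ω⊆τ) = inj₁ (x ∷ʳ ω⊆τ)
  ... | yes _ | _ ∷ʳ (y≡x ∷ ω⊆τ) = inj₁ (y≡x ∷ ω⊆τ)
  ... | yes _ | y≡x ∷ (_ ∷ʳ ω⊆τ) = inj₁ (y≡x ∷ ω⊆τ)
  ... | yes refl | refl ∷ (refl ∷ _) = inj₂ ([] , _ , refl)
  ... | no _ | _ ∷ʳ ω⊆ = Sum.map (x ∷ʳ_) id (⊆-dupFirst-cases ω⊆)
  ... | no _ | y≡x ∷ ω⊆ =
    Sum.map (y≡x ∷_) (λ (ys , zs , ω≡) → _ ∷ ys , zs , cong (_ ∷_) ω≡) (⊆-dupFirst-cases ω⊆)

  -- An occurrence not already in τ uses both adjacent copies of m, but neither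
  -- "m m c" nor "a m m" (with a ≤ m) starts with a descent.
  dupFirst-avoids : r₁ < r₀ → All (_≤ m) τ →
    Avoids τ (r₀ ∷ r₁ ∷ r₂ ∷ []) → Avoids (dupFirst m τ) (r₀ ∷ r₁ ∷ r₂ ∷ [])
  dupFirst-avoids r₁<r₀ τ≤m τ-avoids (a ∷ b ∷ c ∷ [] , ω⊆ , ω≅ρ@(_ , <⇔<))
    with ⊆-dupFirst-cases ω⊆
  ... | inj₁ ω⊆τ = τ-avoids (_ , ω⊆τ , ω≅ρ)
  ... | inj₂ ([] , _ , refl) = <-irrefl refl (from (<⇔< (suc zero) zero) r₁<r₀)
  ... | inj₂ (_ ∷ [] , _ , refl) =
    <⇒≱ (from (<⇔< (suc zero) zero) r₁<r₀) (All.head (All-resp-⊆ ω⊆ (All-dupFirst τ≤m)))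
  ... | inj₂ (_ ∷ _ ∷ [] , _ , ())
  ... | inj₂ (_ ∷ _ ∷ _ ∷ [] , _ , ())
  ... | inj₂ (_ ∷ _ ∷ _ ∷ _ ∷ _ , _ , ())
  dupFirst-avoids _ _ _ ([] , _ , () , _)
  dupFirst-avoids _ _ _ (_ ∷ [] , _ , () , _)
  dupFirst-avoids _ _ _ (_ ∷ _ ∷ [] , _ , () , _)
  dupFirst-avoids _ _ _ (_ ∷ _ ∷ _ ∷ _ ∷ _ , _ , () , _)

  -- Avoiding 101, a second m cannot be separated from the first one.
  dupFirst-delFirst : Avoids σ p101 → All (_≤ m) σ → m ∈ delFirst m σ → dupFirst m (delFirst m σ) ≡ σ
  dupFirst-delFirst {x ∷ xs} σ-avoids (_ ∷ xs≤m) m∈ with x ≟ m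
  dupFirst-delFirst {x ∷ []} _ _ () | yes refl
  dupFirst-delFirst {x ∷ y ∷ ys} σ-avoids (_ ∷ y≤m ∷ _) m∈ | yes refl with y ≟ m | m∈
  ... | yes refl | _ = refl
  ... | no y≢m | here m≡y = contradiction (sym m≡y) y≢m
  ... | no y≢m | there m∈ys =
    contradiction (_ , refl ∷ refl ∷ from∈ m∈ys , occurrence-101 (≤∧≢⇒< y≤m y≢m)) σ-avoids
  dupFirst-delFirst {x ∷ xs} σ-avoids (_ ∷ xs≤m) m∈ | no x≢m with m∈
  ... | here m≡x = contradiction (sym m≡x) x≢m
  ... | there m∈′ rewrite dec-no (x ≟ m) x≢m =
    cong (x ∷_) (dupFirst-delFirst (Avoids-⊆ (x ∷ʳ ⊆-refl) σ-avoids) xs≤m m∈′)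

maximum : List ℕ → ℕ
maximum = max 0

maximum-∈ : length σ ≡ suc n → maximum σ ∈ σ
maximum-∈ {x ∷ xs} _ with argmax-sel id 0 (x ∷ xs)
... | inj₂ max∈σ = max∈σ
... | inj₁ max≡0 =
  here (trans max≡0 (sym (n≤0⇒n≡0 (subst (x ≤_) max≡0 (All.head (xs≤max 0 (x ∷ xs)))))))

maximum≡ : m ∈ σ → All (_≤ m) σ → maximum σ ≡ m
maximum≡ m∈σ σ≤m = max≈v⁺ m∈σ σ≤m z≤n

dropMax : List ℕ → List ℕ
dropMax σ = delFirst (maximum σ) σ

doubleMax : List ℕ → List ℕ
doubleMax τ = dupFirst (maximum τ) τ

maxPos : List ℕ → ℕ
maxPos σ = suc (firstIdx (maximum σ) σ)

RepeatedMax : List ℕ → Set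
RepeatedMax σ = maximum σ ∈ dropMax σ

RepeatedMax? : Decidable RepeatedMax
RepeatedMax? σ = maximum σ ∈? dropMax σ

maximum-dropMax : ∀ σ → RepeatedMax σ → maximum (dropMax σ) ≡ maximum σ
maximum-dropMax σ rep = maximum≡ rep (All-resp-⊆ (delFirst-⊆ σ) (xs≤max 0 σ))

maximum-doubleMax : maximum τ ∈ τ → maximum (doubleMax τ) ≡ maximum τ
maximum-doubleMax {τ} max∈τ =
  maximum≡ (Sublist.lookup (⊆-dupFirst τ) max∈τ) (All-dupFirst (xs≤max 0 τ))

doubleMax-dropMax : ∀ σ → Avoids σ p101 → RepeatedMax σ → doubleMax (dropMax σ) ≡ σ
doubleMax-dropMax σ σ-avoids rep =
  trans (cong (λ m → dupFirst m (dropMax σ)) (maximum-dropMax σ rep))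
        (dupFirst-delFirst σ-avoids (xs≤max 0 σ) rep)

dropMax-doubleMax : maximum τ ∈ τ → dropMax (doubleMax τ) ≡ τ
dropMax-doubleMax {τ} max∈τ =
  trans (cong (λ m → delFirst m (doubleMax τ)) (maximum-doubleMax max∈τ)) (delFirst-dupFirst τ)

dropMax-InI : InI (suc n) σ × RepeatedMax σ → InI n (dropMax σ)
dropMax-InI {σ = σ} (((len , σᵢ<i) , avoids-100 , avoids-101) , rep) =
  (suc-injective (trans (length-delFirst max∈σ) len) ,
   to (InvSeqFrom⇔lookup 1 _)
      (delFirst-InvSeqFrom max∈σ (xs≤max 0 σ) (from (InvSeqFrom⇔lookup 1 σ) σᵢ<i))) ,
  Avoids-⊆ (delFirst-⊆ σ) avoids-100 , Avoids-⊆ (delFirst-⊆ σ) avoids-101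
  where
  max∈σ = Sublist.lookup (delFirst-⊆ σ) rep

doubleMax-InI : InI (suc n) τ → InI (suc (suc n)) (doubleMax τ) × RepeatedMax (doubleMax τ)
doubleMax-InI {τ = τ} ((len , τᵢ<i) , avoids-100 , avoids-101) =
  ((trans (length-dupFirst max∈τ) (cong suc len) ,
    to (InvSeqFrom⇔lookup 1 _) (dupFirst-InvSeqFrom (from (InvSeqFrom⇔lookup 1 τ) τᵢ<i))) ,
   dupFirst-avoids (s≤s z≤n) (xs≤max 0 τ) avoids-100 ,
   dupFirst-avoids (s≤s z≤n) (xs≤max 0 τ) avoids-101) ,
  subst (λ m → m ∈ delFirst m (doubleMax τ)) (sym (maximum-doubleMax max∈τ))
    (subst (maximum τ ∈_) (sym (delFirst-dupFirst τ)) max∈τ)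
  where
  max∈τ = maximum-∈ len

uniqueMax⇒ASet : ((InI (suc n) σ × ¬ RepeatedMax σ) × maximum σ ≡ m) × maxPos σ ≡ p → ASet (suc n) m p σ
uniqueMax⇒ASet {σ = σ} (((inI@((len , _) , _) , unique) , refl) , refl) =
  inI , from (MaxOnceAt⇔ {σ = σ}) (xs≤max 0 σ , maximum-∈ len , unique , refl)

ASet⇒uniqueMax : ASet (suc n) m p σ → ((InI (suc n) σ × ¬ RepeatedMax σ) × maximum σ ≡ m) × maxPos σ ≡ p
ASet⇒uniqueMax {σ = σ} (inI , once) =
  let σ≤m , m∈σ , m∉ , pos = to (MaxOnceAt⇔ {σ = σ}) once
      max≡m = maximum≡ m∈σ σ≤m
  in ((inI , subst (λ m → ¬ m ∈ delFirst m σ) (sym max≡m) m∉) , max≡m) ,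
     trans (cong (λ m → suc (firstIdx m σ)) max≡m) pos

no-RepeatedMax-in-length-1 : ∀ σ → length σ ≡ 1 → ¬ RepeatedMax σ
no-RepeatedMax-in-length-1 (x ∷ []) refl = ∉-delFirst-singleton x

module Counting (a : ℕ → ℕ → ℕ → ℕ) (a-card : ∀ ℓ m p → HasCard (ASet ℓ m p) (a ℓ m p)) where

  uniqueMaxTotal : ℕ → ℕ
  uniqueMaxTotal ℓ = sumFromTo 0 (ℓ ∸ 1) (λ m → sumFromTo (suc m) ℓ (λ p → a ℓ m p))

  count-uniqueMax : ∀ k {c} → HasCard (λ σ → InI (suc k) σ × ¬ RepeatedMax σ) c →
    c ≡ uniqueMaxTotal (suc k)
  count-uniqueMax k = HasCard-sum-fibres maximum 0 (suc k) _ max-range λ m →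
    HasCard-sum-fibres maxPos (suc m) (suc k ∸ m) _ (pos-range m) λ i card →
    HasCard-unique (HasCard-resp-⇔ (λ _ → mk⇔ uniqueMax⇒ASet ASet⇒uniqueMax) card)
                   (a-card (suc k) m (suc m + i))
    where
    bounds : InI (suc k) σ → maximum σ ≤ firstIdx (maximum σ) σ × firstIdx (maximum σ) σ < suc k
    bounds {σ} (invSeq@(len , _) , _) = firstIdx-bounds {σ = σ} invSeq (maximum-∈ len)
    max-range : InI (suc k) σ × ¬ RepeatedMax σ → 0 ≤ maximum σ × maximum σ < suc k
    max-range {σ} (inI , _) = let max≤ , <n = bounds {σ} inI in z≤n , ≤-<-trans max≤ <n
    pos-range : ∀ m → (InI (suc k) σ × ¬ RepeatedMax σ) × maximum σ ≡ m →
      suc m ≤ maxPos σ × maxPos σ < suc m + (suc k ∸ m)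
    pos-range {σ} _ ((inI , _) , refl) = let max≤ , <n = bounds {σ} inI in
      s≤s max≤ ,
      s≤s (subst (firstIdx (maximum σ) σ <_) (sym (m+[n∸m]≡n (≤-trans max≤ (<⇒≤ <n)))) <n)

  count : ∀ k {N} → HasCard (InI (suc k)) N → N ≡ sumFromTo 1 (suc k) uniqueMaxTotal
  count-repeatedMax : ∀ k {N} → HasCard (λ σ → InI (suc k) σ × RepeatedMax σ) N →
    N ≡ sumFromTo 1 k uniqueMaxTotal

  count k card with _ , _ , card-rep , card-unique , refl ← HasCard-partition card RepeatedMax? =
    trans (cong₂ _+_ (count-repeatedMax k card-rep) (count-uniqueMax k card-unique))
          (sym (sum-upTo-suc (uniqueMaxTotal ∘ suc) k))

  count-repeatedMax zero =
    HasCard-empty λ σ (((len , _) , _) , rep) → no-RepeatedMax-in-length-1 σ len rep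
  count-repeatedMax (suc k) = count k ∘ HasCard-bijection dropMax doubleMax dropMax-InI doubleMax-InI
    (λ {σ} ((_ , _ , avoids-101) , rep) → doubleMax-dropMax σ avoids-101 rep)
    (λ ((len , _) , _) → dropMax-doubleMax (maximum-∈ len))

theorem7 : (n : ℕ) → 2 ≤ n →
    (N : ℕ) → HasCard (InI n) N →
    (a : ℕ → ℕ → ℕ → ℕ) → (∀ ℓ m p → HasCard (ASet ℓ m p) (a ℓ m p)) →
    N ≡ sumFromTo 1 n (λ ℓ → sumFromTo 0 (ℓ ∸ 1) (λ m → sumFromTo (suc m) ℓ (λ p → a ℓ m p)))
theorem7 (suc k) _ N card a a-card = Counting.count a a-card k card
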